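{- Let $(P,e)$, $P\in\mathcal{T}_k$, be a tree pattern, and let $X,Y,Y'\subseteq[k]$ be defined with respect to $(P,e)$ as below. Let $i\in X\cup Y\cup Y'$ be a non-root vertex of $P$ with $e(i)=0$, and define $e'\colon[k]\setminus\{r(P)\}\to\{0,1\}$ by $e'(i)=1$ and $e'(j)=e(j)$ for all $j\ne i$. Then $\mathcal{T}_n(P,e)=\mathcal{T}_n(P,e')$ for all $n\ge0$.
   Context: $\mathcal{T}_n$ is the set of binary trees on $n$ vertices labeled $1,\dots,n$ by the search tree property (left-subtree vertices of $i$ smaller than $i$, right-subtree vertices larger). $c_L(i),c_R(i),p(i)$: left child, right child, parent ($\varepsilon$ if nonexistent); $c_L^\ell,c_R^\ell$ denote iterates; $r(T)$ root; $L(i),R(i)$ subtrees rooted at $c_L(i),c_R(i)$. A tree pattern is $(P,e)$, $P\in\mathcal{T}_k$, $e\colon[k]\setminus\{r(P)\}\to\{0,1\}$ ($e(i)=1$: edge $(i,p(i))$ contiguous; $e(i)=0$: non-contiguous). $T\in\mathcal{T}_n$ contains $(P,e)$ if there is an injection $f\colon[k]\to[n]$ such that for every non-root $i$ of $P$: if $e(i)=1$, $f(i)$ is the left (resp. right) child of $f(p(i))$ when $i$ is the left (resp. right) child of $p(i)$; if $e(i)=0$, $f(i)\in L(f(p(i)))$ (resp. $R(f(p(i)))$) accordingly. $\mathcal{T}_n(P,e)$ is the set of $T\in\mathcal{T}_n$ avoiding $(P,e)$. For $i\in[k]$: $B_L'(i)=\{c_L^\ell(i):\ell\ge0,\ c_L^\ell(i)\text{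 exists, and } e(c_L^j(i))=1\text{ for } j=1,\dots,\ell\}$; $A_R(i)=\{a\in[k]: i=c_R^\ell(a)\text{ for some }\ell\ge0\text{ with } e(c_R^j(a))=1\text{ for } j=1,\dots,\ell\}$, and $a_R(i)$ is the topmost (closest to the root) vertex of $A_R(i)$. $B_R'(i)$, $A_L(i)$, $a_L(i)$ are defined in the same way with left and right interchanged. Then $X=\{i: c_L(i)=\varepsilon\text{ and } c_R(i)=\varepsilon\}$ (the leaves); $Y$ is the set of $i$ such that: $c_L(i)\ne\varepsilon$; $i=c_R(p(i))$; $A_R(p(i))=\{p(i)\}$ or $B_L'(i)=\{i\}$; $c_L(j)=\varepsilon$ for all $j\in A_R(p(i))$; $c_R(j)=\varepsilon$ for all $j\in B_L'(i)$; and $a_R(p(i))=r(P)$ or $e(a_R(p(i)))=0$; $Y'$ is the set of $i$ such that: $c_R(i)\ne\varepsilon$; $i=c_L(p(i))$; $A_L(p(i))=\{p(i)\}$ or $B_R'(i)=\{i\}$; $c_R(j)=\varepsilon$ for all $j\in A_L(p(i))$; $c_L(j)=\varepsilon$ for all $j\in B_R'(i)$; and $a_L(p(i))=r(P)$ or $e(a_L(p(i)))=0$. -}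

module Defs where

open import Level using (0ℓ)
open import Data.Bool.Base using (Bool; true; false; if_then_else_)
open import Data.Fin.Base using (Fin; _<_)
open import Data.Fin.Properties using (_≟_)
open import Data.Maybe.Base using (Maybe; just; nothing; _>>=_)
open import Data.Nat.Base using (ℕ; zero; suc; _≤_)
open import Data.Product.Base using (_×_; Σ-syntax; ∃-syntax)
open import Data.Refinement.Base using (Refinement-syntax; value)
open import Data.Sum.Base using (_⊎_)
open import Data.Tree.Binary using (Tree; leaf; node)
open import Data.Unit.Base using (⊤)
open import Function.Definitions using (Injective)
open import Relation.Binary.PropositionalEquality.Core using (_≡_; _≢_)
open import Relation.Nullary.Decidable.Core using (does)
open import Relation.Nullary.Negation.Core using (¬_)
open import Relation.Unary using (Pred; _∈_; _≐_; ｛_｝)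

data Side : Set where
  left right : Side

opposite : Side → Side
opposite left  = right
opposite right = left

-- Vertices are the `node`s; a `leaf` is an empty (sub)tree.
BinTree : Set → Set
BinTree A = Tree A ⊤

infix 4 _∈ᵗ_

data _∈ᵗ_ {A : Set} (x : A) : BinTree A → Set where
  here : ∀ {l r} → x ∈ᵗ node l x r
  inˡ  : ∀ {l y r} → x ∈ᵗ l → x ∈ᵗ node l y r
  inʳ  : ∀ {l y r} → x ∈ᵗ r → x ∈ᵗ node l y r

rootOf : {A : Set} → BinTree A → Maybe A
rootOf (leaf _)     = nothing
rootOf (node _ x _) = just x

subtreeBelow : {A : Set} {x : A} {t : BinTree A} → Side → x ∈ᵗ t → BinTree A
subtreeBelow left  (here {l} {r}) = l
subtreeBelow right (here {l} {r}) = r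
subtreeBelow s     (inˡ x∈l)      = subtreeBelow s x∈l
subtreeBelow s     (inʳ x∈r)      = subtreeBelow s x∈r

parentAt : {A : Set} {x : A} {t : BinTree A} → x ∈ᵗ t → Maybe A
parentAt here                   = nothing
parentAt (inˡ {y = y} here)     = just y
parentAt (inˡ x∈l@(inˡ _))      = parentAt x∈l
parentAt (inˡ x∈l@(inʳ _))      = parentAt x∈l
parentAt (inʳ {y = y} here)     = just y
parentAt (inʳ x∈r@(inˡ _))      = parentAt x∈r
parentAt (inʳ x∈r@(inʳ _))      = parentAt x∈r

depthAt : {A : Set} {x : A} {t : BinTree A} → x ∈ᵗ t → ℕ
depthAt here      = 0
depthAt (inˡ x∈l) = suc (depthAt x∈l)
depthAt (inʳ x∈r) = suc (depthAt x∈r)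

data SearchTree {n : ℕ} : BinTree (Fin n) → Set where
  leaf : ∀ {u} → SearchTree (leaf u)
  node : ∀ {l x r} →
         SearchTree l → (∀ {y} → y ∈ᵗ l → y < x) →
         SearchTree r → (∀ {y} → y ∈ᵗ r → x < y) →
         SearchTree (node l x r)

-- Binary trees on n vertices labelled by the search tree property, with
-- Fin n as the label set [n].  The strict inequalities in `search` make the
-- labels distinct and `position` makes each of them occur, so there are
-- exactly n vertices and `position i` is the only occurrence of i.
record 𝒯 (n : ℕ) : Set where
  field
    tree     : BinTree (Fin n)
    search   : SearchTree tree
    position : ∀ i → i ∈ᵗ tree

module _ {n : ℕ} (T : 𝒯 n) where
  open 𝒯 T

  -- `nothing` plays the role of ε.
  root : Maybe (Fin n)
  root = rootOf tree

  -- L(i) and R(i)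
  subtree : Side → Fin n → BinTree (Fin n)
  subtree s i = subtreeBelow s (position i)

  -- c_L(i) and c_R(i)
  child : Side → Fin n → Maybe (Fin n)
  child s i = rootOf (subtree s i)

  parent : Fin n → Maybe (Fin n)
  parent i = parentAt (position i)

  depth : Fin n → ℕ
  depth i = depthAt (position i)

  -- c_L^ℓ(i) and c_R^ℓ(i)
  child^ : Side → ℕ → Fin n → Maybe (Fin n)
  child^ s zero    i = just i
  child^ s (suc ℓ) i = child^ s ℓ i >>= child s

  -- The vertex set without the root, [n] ∖ {r(T)}.
  NonRoot : Set
  NonRoot = [ i ∈ Fin n ∣ root ≢ just i ]

  -- `true` is 1 (contiguous edge to the parent), `false` is 0 (non-contiguous).
  EdgeType : Set
  EdgeType = NonRoot → Bool

makeContiguous : ∀ {k} {P : 𝒯 k} → NonRoot P → EdgeType P → EdgeType P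
makeContiguous i e j = if does (value j ≟ value i) then true else e j

record Contains {n k : ℕ} (T : 𝒯 n) (P : 𝒯 k) (e : EdgeType P) : Set where
  field
    f             : Fin k → Fin n
    injective     : Injective _≡_ _≡_ f
    contiguous    : ∀ (i : NonRoot P) {q} s →
                    parent P (value i) ≡ just q → child P s q ≡ just (value i) →
                    e i ≡ true → child T s (f q) ≡ just (f (value i))
    noncontiguous : ∀ (i : NonRoot P) {q} s →
                    parent P (value i) ≡ just q → child P s q ≡ just (value i) →
                    e i ≡ false → f (value i) ∈ᵗ subtree T s (f q)

-- 𝒯_n(P,e)
Avoiding : ∀ {k} (n : ℕ) (P : 𝒯 k) → EdgeType P → Pred (𝒯 n) 0ℓ
Avoiding n P e T = ¬ Contains T P e

module _ {k : ℕ} (P : 𝒯 k) (e : EdgeType P) where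

  -- c_s^ℓ(a) = b, with e(c_s^j(a)) = 1 for j = 1,…,ℓ
  ContiguousChain : Side → ℕ → Fin k → Fin k → Set
  ContiguousChain s ℓ a b =
    child^ P s ℓ a ≡ just b ×
    (∀ j → 1 ≤ j → j ≤ ℓ →
       Σ[ v ∈ NonRoot P ] (child^ P s j a ≡ just (value v) × e v ≡ true))

  -- B_L'(i) and B_R'(i)
  B′ : Side → Fin k → Pred (Fin k) 0ℓ
  B′ s i b = ∃[ ℓ ] ContiguousChain s ℓ i b

  -- A_L(i) and A_R(i)
  A : Side → Fin k → Pred (Fin k) 0ℓ
  A s i a = ∃[ ℓ ] ContiguousChain s ℓ a i

  -- a = a_L(i) and a = a_R(i), respectively
  IsTopmostA : Side → Fin k → Fin k → Set
  IsTopmostA s i a = a ∈ A s i × (∀ {b} → b ∈ A s i → depth P a ≤ depth P b)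

  X : Pred (Fin k) 0ℓ
  X i = child P left i ≡ nothing × child P right i ≡ nothing

  -- The common form of Y (s = right) and Y' (s = left); q is p(i) and
  -- top is a_s(p(i)).
  record YOn (s : Side) (i : Fin k) : Set where
    field
      hasChild  : child P (opposite s) i ≢ nothing
      q         : Fin k
      isParent  : parent P i ≡ just q
      isChild   : child P s q ≡ just i
      singleton : A s q ≐ ｛ q ｝ ⊎ B′ (opposite s) i ≐ ｛ i ｝
      above     : ∀ {j} → j ∈ A s q → child P (opposite s) j ≡ nothing
      below     : ∀ {j} → j ∈ B′ (opposite s) i → child P s j ≡ nothing
      top       : Fin k
      isTop     : IsTopmostA s q top
      topEdge   : root P ≡ just top ⊎
                  (Σ[ v ∈ NonRoot P ] (value v ≡ top × e v ≡ false))

  Y : Pred (Fin k) 0ℓ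
  Y = YOn right

  Y′ : Pred (Fin k) 0ℓ
  Y′ = YOn left

{-# OPTIONS --safe #-}
module Submission where

-- Containment of (P,e) does not depend on labels: it is an `Embedding` of the
-- pattern tree into the host tree, the root of P being treated like a vertex
-- with a non-contiguous edge.  Since a subpattern hanging from a non-contiguous
-- edge may be embedded anywhere below, it suffices to re-embed the subpattern
-- rooted at i (for X) or at the topmost vertex of A(p(i)) (for Y and Y').
--   * If i is a leaf, it can be moved up to the child of the image of p(i).
--   * If A(p(i)) = {p(i)}, the chain B'(i) is shifted upwards for as long as it
--     sits in an (opposite s)-subtree, and p(i) is then moved down to the parent
--     of the image of i.
--   * If B'(i) = {i}, the chain A(p(i)) is shifted downwards until the image of i
--     is the s-child of the image of p(i) or lies in the (opposite s)-subtree of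
--     that child; in the latter case i is moved up to that child.

open import Defs
open import Data.Bool.Base using (Bool; true; false)
open import Data.Fin.Base using (Fin)
open import Data.Fin.Properties using (_≟_; <-irrefl; <-asym; <-trans; <⇒≢)
open import Data.Irrelevant using ([_])
open import Data.Maybe.Base using (just; nothing; _>>=_)
open import Data.Maybe.Properties using (≡-dec)
open import Data.Nat.Base using (ℕ; zero; suc; _≤_; z≤n; s≤s)
open import Data.Nat.Properties using (m≤n⇒m<n∨m≡n; ≤-refl; m≤n⇒m≤1+n)
open import Data.Product.Base using (∃-syntax; _×_; _,_; proj₁; proj₂)
open import Data.Refinement.Base using (value; _,_)
open import Data.Sum.Base using (_⊎_; inj₁; inj₂)
open import Data.Tree.Binary using (leaf; node)
open import Data.Unit.Base using (tt)
open import Function.Base using (_∘_; case_of_)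
open import Relation.Binary.PropositionalEquality.Core using (_≡_; _≢_; refl; sym; trans; cong; cong₂; subst)
open import Relation.Nullary.Decidable.Core using (yes; no)
open import Relation.Nullary.Negation.Core using (contradiction; contradiction-irr)
open import Relation.Unary using (_∈_; _∪_; _≐_; ｛_｝)

private
  variable
    V W : Set
    x y : V
    ê ê′ : V → Bool
    l r p t u : BinTree V

-- Subtrees and positions

sub : Side → BinTree V → BinTree V
sub s     (leaf u)     = leaf u
sub left  (node l _ _) = l
sub right (node _ _ r) = r

treeAt : {x : V} {t : BinTree V} → x ∈ᵗ t → BinTree V
treeAt {x = x} (here {l} {r}) = node l x r
treeAt (inˡ c)                = treeAt c
treeAt (inʳ c)                = treeAt c

treeAt-η : (c : x ∈ᵗ t) → treeAt c ≡ node (subtreeBelow left c) x (subtreeBelow right c)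
treeAt-η here    = refl
treeAt-η (inˡ c) = treeAt-η c
treeAt-η (inʳ c) = treeAt-η c

subtreeBelow≡sub : ∀ s (c : x ∈ᵗ t) → subtreeBelow s c ≡ sub s (treeAt c)
subtreeBelow≡sub left  c = sym (cong (sub left) (treeAt-η c))
subtreeBelow≡sub right c = sym (cong (sub right) (treeAt-η c))

root∈ : rootOf t ≡ just x → x ∈ᵗ t
root∈ {t = node _ _ _} refl = here

treeAt-root∈ : (eq : rootOf t ≡ just x) → treeAt (root∈ {t = t} eq) ≡ t
treeAt-root∈ {t = node _ _ _} refl = refl

parentAt-root∈ : (eq : rootOf t ≡ just x) → parentAt (root∈ {t = t} eq) ≡ nothing
parentAt-root∈ {t = node _ _ _} refl = refl

rootOf-nothing : rootOf t ≡ nothing → t ≡ leaf tt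
rootOf-nothing {t = leaf tt} refl = refl

sub⊆ : ∀ s → y ∈ᵗ sub s t → y ∈ᵗ t
sub⊆ {t = node _ _ _} left  d = inˡ d
sub⊆ {t = node _ _ _} right d = inʳ d

treeAt-sub⊆ : ∀ s (d : y ∈ᵗ sub s t) → treeAt (sub⊆ {t = t} s d) ≡ treeAt d
treeAt-sub⊆ {t = node _ _ _} left  d = refl
treeAt-sub⊆ {t = node _ _ _} right d = refl

descend : (c : x ∈ᵗ t) → y ∈ᵗ treeAt c → y ∈ᵗ t
descend here    d = d
descend (inˡ c) d = inˡ (descend c d)
descend (inʳ c) d = inʳ (descend c d)

treeAt-descend : (c : x ∈ᵗ t) (d : y ∈ᵗ treeAt c) → treeAt (descend c d) ≡ treeAt d
treeAt-descend here    d = refl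
treeAt-descend (inˡ c) d = treeAt-descend c d
treeAt-descend (inʳ c) d = treeAt-descend c d

parentAt-inˡ : (c : x ∈ᵗ l) {q : V} → parentAt c ≡ just q → parentAt (inˡ {y = y} {r = r} c) ≡ just q
parentAt-inˡ (inˡ _) eq = eq
parentAt-inˡ (inʳ _) eq = eq

parentAt-inʳ : (c : x ∈ᵗ r) {q : V} → parentAt c ≡ just q → parentAt (inʳ {l = l} {y = y} c) ≡ just q
parentAt-inʳ (inˡ _) eq = eq
parentAt-inʳ (inʳ _) eq = eq

parentAt-child : (c : x ∈ᵗ t) → ∀ s (eq : rootOf (sub s (treeAt c)) ≡ just y) →
                 parentAt (descend c (sub⊆ {t = treeAt c} s (root∈ eq))) ≡ just x
parentAt-child (here {l = node _ _ _}) left  refl = refl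
parentAt-child (here {r = node _ _ _}) right refl = refl
parentAt-child (inˡ c) s eq = parentAt-inˡ (descend c (sub⊆ {t = treeAt c} s (root∈ eq))) (parentAt-child c s eq)
parentAt-child (inʳ c) s eq = parentAt-inʳ (descend c (sub⊆ {t = treeAt c} s (root∈ eq))) (parentAt-child c s eq)

-- Uniqueness of positions in search trees

module _ {n : ℕ} where

  -- The order separates the two subtrees of a vertex from it and from each other. Any position
  -- found for x can therefore be exchanged for `position x`.
  ∈ᵗ-unique : {t : BinTree (Fin n)} {x : Fin n} → SearchTree t → (c d : x ∈ᵗ t) → c ≡ d
  ∈ᵗ-unique _                  here    here    = refl
  ∈ᵗ-unique (node _ l< _ _)    here    (inˡ d) = contradiction (l< d) (<-irrefl refl)
  ∈ᵗ-unique (node _ _ _ <r)    here    (inʳ d) = contradiction (<r d) (<-irrefl refl)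
  ∈ᵗ-unique (node _ l< _ _)    (inˡ c) here    = contradiction (l< c) (<-irrefl refl)
  ∈ᵗ-unique (node sl _ _ _)    (inˡ c) (inˡ d) = cong inˡ (∈ᵗ-unique sl c d)
  ∈ᵗ-unique (node _ l< _ <r)   (inˡ c) (inʳ d) = contradiction (l< c) (<-asym (<r d))
  ∈ᵗ-unique (node _ _ _ <r)    (inʳ c) here    = contradiction (<r c) (<-irrefl refl)
  ∈ᵗ-unique (node _ l< _ <r)   (inʳ c) (inˡ d) = contradiction (l< d) (<-asym (<r c))
  ∈ᵗ-unique (node _ _ sr _)    (inʳ c) (inʳ d) = cong inʳ (∈ᵗ-unique sr c d)

  ∈-sub⇒≢ : {t : BinTree (Fin n)} {x y : Fin n} → SearchTree t →
            (c : x ∈ᵗ t) → ∀ s → y ∈ᵗ sub s (treeAt c) → y ≢ x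
  ∈-sub⇒≢ (node _ l< _ _) here    left  d = <⇒≢ (l< d)
  ∈-sub⇒≢ (node _ _ _ <r) here    right d = <⇒≢ (<r d) ∘ sym
  ∈-sub⇒≢ (node sl _ _ _) (inˡ c) s     d = ∈-sub⇒≢ sl c s d
  ∈-sub⇒≢ (node _ _ sr _) (inʳ c) s     d = ∈-sub⇒≢ sr c s d

  module _ (P : 𝒯 n) where
    open 𝒯 P

    -- The subtree rooted at x, written so that its outermost `node` is visible definitionally;
    -- `treeAt (position x)` does not reduce.
    full : Fin n → BinTree (Fin n)
    full x = node (subtree P left x) x (subtree P right x)

    treeAt≡full : {x : Fin n} (c : x ∈ᵗ tree) → treeAt c ≡ full x
    treeAt≡full {x} c = trans (cong treeAt (∈ᵗ-unique search c (position x))) (treeAt-η (position x))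

    ∈-subtree⇒≢ : ∀ s {x y} → y ∈ᵗ subtree P s x → y ≢ x
    ∈-subtree⇒≢ s {x} d = ∈-sub⇒≢ search (position x) s (subst (_ ∈ᵗ_) (subtreeBelow≡sub s (position x)) d)

    treeAt-sub : ∀ s x {y u} → u ≡ sub s (treeAt (position x)) → (d : y ∈ᵗ u) → treeAt d ≡ full y
    treeAt-sub s x refl d =
      trans (sym (trans (treeAt-descend (position x) d′) (treeAt-sub⊆ {t = treeAt (position x)} s d)))
            (treeAt≡full (descend (position x) d′))
      where d′ = sub⊆ {t = treeAt (position x)} s d

    treeAt-subtree : ∀ s x {y} (d : y ∈ᵗ subtree P s x) → treeAt d ≡ full y
    treeAt-subtree s x = treeAt-sub s x (subtreeBelow≡sub s (position x))

    subtree≡full : ∀ s {x y} → child P s x ≡ just y → subtree P s x ≡ full y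
    subtree≡full s {x} eq = trans (sym (treeAt-root∈ eq)) (treeAt-subtree s x (root∈ eq))

    child-sub : ∀ s {x y} → child P s x ≡ just y → rootOf (sub s (treeAt (position x))) ≡ just y
    child-sub s {x} eq = trans (cong rootOf (sym (subtreeBelow≡sub s (position x)))) eq

    child⇒parent : ∀ s {x y} → child P s x ≡ just y → parent P y ≡ just x
    child⇒parent s {x} {y} eq =
      trans (cong parentAt (∈ᵗ-unique search (position y) (descend (position x) (sub⊆ s (root∈ eq′)))))
            (parentAt-child (position x) s eq′)
      where eq′ = child-sub s eq

    root⇒no-parent : ∀ {x} → root P ≡ just x → parent P x ≡ nothing
    root⇒no-parent {x} eq =
      trans (cong parentAt (∈ᵗ-unique search (position x) (root∈ eq))) (parentAt-root∈ eq)

    child⇒≢root : ∀ s {x y} → child P s x ≡ just y → root P ≢ just y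
    child⇒≢root s eq eqʳ with trans (sym (child⇒parent s eq)) (root⇒no-parent eqʳ)
    ... | ()

-- Embeddings of patterns

-- ê x tells whether the edge from x to its parent is contiguous; for the root of
-- the pattern, a contiguous edge means that it is mapped to the root of the host.
data Embedding {V W : Set} (ê : V → Bool) : BinTree V → BinTree W → Set where
  leaf  : ∀ {u t} → Embedding ê (leaf u) t
  at    : ∀ {l x r l′ y r′} → Embedding ê l l′ → Embedding ê r r′ →
          Embedding ê (node l x r) (node l′ y r′)
  intoˡ : ∀ {l x r l′ y r′} → ê x ≡ false → Embedding ê (node l x r) l′ →
          Embedding ê (node l x r) (node l′ y r′)
  intoʳ : ∀ {l x r l′ y r′} → ê x ≡ false → Embedding ê (node l x r) r′ →
          Embedding ê (node l x r) (node l′ y r′)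

into : (c : y ∈ᵗ t) → ê x ≡ false → Embedding ê (node l x r) (treeAt c) → Embedding ê (node l x r) t
into here    eq D = D
into (inˡ c) eq D = intoˡ eq (into c eq D)
into (inʳ c) eq D = intoʳ eq (into c eq D)

-- Only the `into` constructors consult the edge types, and only to ask for `false`; hence it is
-- enough that non-contiguous edges stay so.
relax : (∀ {x} → x ∈ᵗ p → ê x ≡ false → ê′ x ≡ false) → Embedding ê p t → Embedding ê′ p t
relax h leaf         = leaf
relax h (at Dl Dr)   = at (relax (h ∘ inˡ) Dl) (relax (h ∘ inʳ) Dr)
relax h (intoˡ eq D) = intoˡ (h here eq) (relax h D)
relax h (intoʳ eq D) = intoʳ (h here eq) (relax h D)

image : {t : BinTree W} → Embedding ê p t → x ∈ᵗ p → W
image (at {y = y} _ _) here    = y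
image (at Dl _)        (inˡ c) = image Dl c
image (at _ Dr)        (inʳ c) = image Dr c
image (intoˡ _ D)      c       = image D c
image (intoʳ _ D)      c       = image D c

image∈ : (D : Embedding ê p t) (c : x ∈ᵗ p) → image D c ∈ᵗ t
image∈ (at _ _)    here    = here
image∈ (at Dl _)   (inˡ c) = inˡ (image∈ Dl c)
image∈ (at _ Dr)   (inʳ c) = inʳ (image∈ Dr c)
image∈ (intoˡ _ D) c       = inˡ (image∈ D c)
image∈ (intoʳ _ D) c       = inʳ (image∈ D c)

restrict : (D : Embedding ê p t) (c : x ∈ᵗ p) → ∀ s →
           Embedding ê (sub s (treeAt c)) (sub s (treeAt (image∈ D c)))
restrict (at Dl _)   here    left  = Dl
restrict (at _ Dr)   here    right = Dr
restrict (at Dl _)   (inˡ c) s     = restrict Dl c s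
restrict (at _ Dr)   (inʳ c) s     = restrict Dr c s
restrict (intoˡ _ D) c       s     = restrict D c s
restrict (intoʳ _ D) c       s     = restrict D c s

image-restrict : (D : Embedding ê p t) (c : x ∈ᵗ p) → ∀ s (d : y ∈ᵗ sub s (treeAt c)) →
                 image D (descend c (sub⊆ {t = treeAt c} s d)) ≡ image (restrict D c s) d
image-restrict (at _ _)    here    left  d = refl
image-restrict (at _ _)    here    right d = refl
image-restrict (at Dl _)   (inˡ c) s     d = image-restrict Dl c s d
image-restrict (at _ Dr)   (inʳ c) s     d = image-restrict Dr c s d
image-restrict (intoˡ _ D) c       s     d = image-restrict D c s d
image-restrict (intoʳ _ D) c       s     d = image-restrict D c s d

image-root : (D : Embedding ê p t) (eq : rootOf p ≡ just x) → ê x ≡ true →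
             rootOf t ≡ just (image D (root∈ eq))
image-root (at _ _)       refl _  = refl
image-root (intoˡ eq′ _)  refl eq = contradiction (trans (sym eq) eq′) λ ()
image-root (intoʳ eq′ _)  refl eq = contradiction (trans (sym eq) eq′) λ ()

image-injective : ∀ {n} {t : BinTree (Fin n)} → SearchTree t → (D : Embedding ê p t)
                  (c : x ∈ᵗ p) (d : y ∈ᵗ p) → image D c ≡ image D d → x ≡ y
image-injective st (at _ _) here here _ = refl
image-injective (node _ l< _ _) (at Dl _) here (inˡ d) eq = contradiction (sym eq) (<⇒≢ (l< (image∈ Dl d)))
image-injective (node _ _ _ <r) (at _ Dr) here (inʳ d) eq = contradiction eq (<⇒≢ (<r (image∈ Dr d)))
image-injective (node _ l< _ _) (at Dl _) (inˡ c) here eq = contradiction eq (<⇒≢ (l< (image∈ Dl c)))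
image-injective (node _ _ _ <r) (at _ Dr) (inʳ c) here eq = contradiction (sym eq) (<⇒≢ (<r (image∈ Dr c)))
image-injective (node sl _ _ _) (at Dl _) (inˡ c) (inˡ d) eq = image-injective sl Dl c d eq
image-injective (node _ _ sr _) (at _ Dr) (inʳ c) (inʳ d) eq = image-injective sr Dr c d eq
image-injective (node _ l< _ <r) (at Dl Dr) (inˡ c) (inʳ d) eq =
  contradiction eq (<⇒≢ (<-trans (l< (image∈ Dl c)) (<r (image∈ Dr d))))
image-injective (node _ l< _ <r) (at Dl Dr) (inʳ c) (inˡ d) eq =
  contradiction (sym eq) (<⇒≢ (<-trans (l< (image∈ Dl d)) (<r (image∈ Dr c))))
image-injective (node sl _ _ _) (intoˡ _ D) c d eq = image-injective sl D c d eq
image-injective (node _ _ sr _) (intoʳ _ D) c d eq = image-injective sr D c d eq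

-- Containment as an embedding

module _ {k : ℕ} (P : 𝒯 k) where

  extend : EdgeType P → Fin k → Bool
  extend e x with ≡-dec _≟_ (root P) (just x)
  ... | yes _  = false
  ... | no ≢x  = e (x , [ ≢x ])

  extend-value : ∀ e (v : NonRoot P) → extend e (value v) ≡ e v
  extend-value e (x , [ ≢x ]) with ≡-dec _≟_ (root P) (just x)
  ... | yes ≡x = contradiction-irr ≢x λ ≢x′ → ≢x′ ≡x
  ... | no _   = refl

  extend-root : ∀ e {x} → root P ≡ just x → extend e x ≡ false
  extend-root e {x} ≡x with ≡-dec _≟_ (root P) (just x)
  ... | yes _ = refl
  ... | no ≢x = contradiction ≡x ≢x

  extend-true : ∀ e x → extend e x ≡ true → ∃[ v ] (value {P = λ i → root P ≢ just i} v ≡ x × e v ≡ true)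
  extend-true e x eq with ≡-dec _≟_ (root P) (just x)
  ... | no ≢x = (x , [ ≢x ]) , refl , eq

  extend-makeContiguous-self : ∀ i e → extend (makeContiguous {P = P} i e) (value i) ≡ true
  extend-makeContiguous-self i e with extend-value (makeContiguous {P = P} i e) i
  ... | eq with value i ≟ value i
  ...   | yes _  = eq
  ...   | no i≢i = contradiction refl i≢i

  extend-makeContiguous-other : ∀ i e {x} → x ≢ value i → extend (makeContiguous {P = P} i e) x ≡ extend e x
  extend-makeContiguous-other i e {x} x≢i with ≡-dec _≟_ (root P) (just x)
  ... | yes _ = refl
  ... | no _ with x ≟ value i
  ...   | yes x≡i = contradiction x≡i x≢i
  ...   | no _    = refl

  module _ {n : ℕ} {T : 𝒯 n} {e : EdgeType P} where
    private
      module P = 𝒯 P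
      module T = 𝒯 T

    -- Structural recursion on the pattern: the s-subtree of x is embedded into the s-subtree of
    -- `f x`, each vertex y landing at `f y`.
    contains⇒embedding : Contains T P e → Embedding (extend e) P.tree T.tree
    contains⇒embedding C = whole P.tree refl
      where
      open Contains C

      place : ∀ s {x y l r} → child P s x ≡ just y →
              Embedding (extend e) (node l y r) (full T (f y)) →
              Embedding (extend e) (node l y r) (subtree T s (f x))
      place s {x} {y} ch D with extend e y in y≡ | extend-value e (y , [ child⇒≢root P s ch ])
      -- A contiguous edge makes `f y` the root of the host subtree; otherwise `into` walks down to
      -- `f y`.
      ... | true  | eq = subst (Embedding (extend e) _) (sym (subtree≡full T s ch′)) D
        where ch′ = contiguous _ s (child⇒parent P s ch) ch (sym eq)
      ... | false | eq = into c y≡ (subst (Embedding (extend e) _) (sym (treeAt-subtree T s (f x) c)) D)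
        where c = noncontiguous _ s (child⇒parent P s ch) ch (sym eq)

      -- The tree p is carried with an equation so that the recursion can be structural on it.
      below : ∀ s p x → p ≡ subtree P s x → Embedding (extend e) p (subtree T s (f x))
      below s (leaf _)     x eq = leaf
      below s (node l y r) x eq =
        place s ch (at (below left l y (cong (sub left) eqʸ)) (below right r y (cong (sub right) eqʸ)))
        where
        ch  = cong rootOf (sym eq)
        eqʸ = trans eq (subtree≡full P s ch)

      whole : ∀ p → p ≡ P.tree → Embedding (extend e) p T.tree
      whole (leaf _)     eq = leaf
      whole (node l x r) eq =
        into (T.position (f x)) (extend-root e ≡x)
          (subst (Embedding (extend e) _) (sym (treeAt≡full T (T.position (f x))))
            (at (below left l x (cong (sub left) eqˣ)) (below right r x (cong (sub right) eqˣ))))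
        where
        ≡x = cong rootOf (sym eq)
        eqˣ = trans eq (trans (sym (treeAt-root∈ ≡x)) (treeAt≡full P (root∈ ≡x)))

    -- Restricting D to the s-subtree of x sends the s-child y to `f y`; `image-root` then settles
    -- contiguous edges and `image∈` non-contiguous ones.
    embedding⇒contains : Embedding (extend e) P.tree T.tree → Contains T P e
    embedding⇒contains D = record
      { f             = f
      ; injective     = λ {x} {y} → image-injective T.search D (P.position x) (P.position y)
      ; contiguous    = λ i s _ ch ei →
          trans (cong rootOf (sym (host s _)))
            (trans (image-root (restrict D (P.position _) s) (child-sub P s ch) (trans (extend-value e i) ei))
                   (cong just (f-child s ch)))
      ; noncontiguous = λ i s _ ch _ →
          subst (_ ∈ᵗ_) (host s _)
            (subst (_∈ᵗ _) (f-child s ch) (image∈ (restrict D (P.position _) s) (root∈ (child-sub P s ch))))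
      }
      where
      f : Fin k → Fin n
      f x = image D (P.position x)

      host : ∀ s x → sub s (treeAt (image∈ D (P.position x))) ≡ subtree T s (f x)
      host s x = trans (cong (sub s ∘ treeAt) (∈ᵗ-unique T.search (image∈ D (P.position x)) (T.position (f x))))
                       (sym (subtreeBelow≡sub s (T.position (f x))))

      f-child : ∀ s {x y} (ch : child P s x ≡ just y) →
                image (restrict D (P.position x) s) (root∈ (child-sub P s ch)) ≡ f y
      f-child s {x} {y} ch =
        trans (sym (image-restrict D (P.position x) s (root∈ (child-sub P s ch))))
              (cong (image D) (∈ᵗ-unique P.search _ (P.position y)))

-- Re-embedding a subpattern

-- By the search tree order, labels outside the subtree at c differ from i, so non-contiguous edges
-- there survive by `keep`. The re-embedding of `treeAt c` is required for all hosts because its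
-- place inside t is not known in advance.
relax-within : ∀ {n} {ê ê′ : Fin n → Bool} {i x : Fin n} {p : BinTree (Fin n)} {t : BinTree W} →
               (∀ {y} → y ≢ i → ê y ≡ false → ê′ y ≡ false) →
               SearchTree p → (c : x ∈ᵗ p) → i ∈ᵗ treeAt c →
               (∀ {t : BinTree W} → Embedding ê (treeAt c) t → Embedding ê′ (treeAt c) t) →
               Embedding ê p t → Embedding ê′ p t
relax-within keep st here i∈ h D = h D
relax-within keep (node sl l< _ <r) (inˡ c) i∈ h (at Dl Dr) =
  at (relax-within keep sl c i∈ h Dl)
     (relax (λ d → keep (<⇒≢ (<-trans (l< (descend c i∈)) (<r d)) ∘ sym)) Dr)
relax-within keep (node _ l< sr <r) (inʳ c) i∈ h (at Dl Dr) =
  at (relax (λ d → keep (<⇒≢ (<-trans (l< d) (<r (descend c i∈))))) Dl)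
     (relax-within keep sr c i∈ h Dr)
relax-within keep st@(node _ l< _ _) (inˡ c) i∈ h (intoˡ eq D) =
  intoˡ (keep (<⇒≢ (l< (descend c i∈)) ∘ sym) eq) (relax-within keep st (inˡ c) i∈ h D)
relax-within keep st@(node _ l< _ _) (inˡ c) i∈ h (intoʳ eq D) =
  intoʳ (keep (<⇒≢ (l< (descend c i∈)) ∘ sym) eq) (relax-within keep st (inˡ c) i∈ h D)
relax-within keep st@(node _ _ _ <r) (inʳ c) i∈ h (intoˡ eq D) =
  intoˡ (keep (<⇒≢ (<r (descend c i∈))) eq) (relax-within keep st (inʳ c) i∈ h D)
relax-within keep st@(node _ _ _ <r) (inʳ c) i∈ h (intoʳ eq D) =
  intoʳ (keep (<⇒≢ (<r (descend c i∈))) eq) (relax-within keep st (inʳ c) i∈ h D)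

-- Any embedding shows that the host is non-empty, and the host's root is a valid place for the
-- vertex whatever the type of its edge.
single-vertex : ∀ {u v} → Embedding ê (node (leaf u) x (leaf v)) t → Embedding ê′ (node (leaf u) x (leaf v)) t
single-vertex (at _ _)    = at leaf leaf
single-vertex (intoˡ _ _) = at leaf leaf
single-vertex (intoʳ _ _) = at leaf leaf

-- Shifting the chain B'(i) upwards

join : Side → BinTree V → V → BinTree V → BinTree V
join left  p x q = node p x q
join right p x q = node q x p

-- Nothing anchors such a pattern to the root of its host, so it survives when the host becomes a
-- subtree of a larger tree.
data Floating {V : Set} (ê : V → Bool) : BinTree V → Set where
  leaf : ∀ {u} → Floating ê (leaf u)
  node : ∀ {l x r} → ê x ≡ false → Floating ê (node l x r)

floatˡ : Floating ê p → Embedding ê p t → Embedding ê p (node t y u)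
floatˡ leaf      _ = leaf
floatˡ (node eq) D = intoˡ eq D

floatʳ : Floating ê p → Embedding ê p t → Embedding ê p (node u y t)
floatʳ leaf      _ = leaf
floatʳ (node eq) D = intoʳ eq D

-- The shape that `below` forces on B'(i): a path along one side without other children, ending in a
-- floating pattern. `link` leaves the edge above x free, so that i can head the chain.
data Chain {V : Set} (ê : V → Bool) (s : Side) : BinTree V → Set where
  end  : ∀ {p} → Floating ê p → Chain ê s p
  link : ∀ {p x} → Chain ê s p → Chain ê s (join s p x (leaf tt))

-- A chain vertex at the root of t moves to the new root above it, and the rest of the chain follows
-- recursively. Once a non-contiguous edge is reached, the remaining pattern stays where it is.
shift-up : ∀ s → Chain ê s p → Embedding ê p t → Embedding ê p (join s t y u)
shift-up left  (end fl) D                = floatˡ fl D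
shift-up right (end fl) D                = floatʳ fl D
shift-up left  (link c) (at Dl _)        = at (shift-up left c Dl) leaf
shift-up left  (link c) D@(intoˡ eq _)   = intoˡ eq D
shift-up left  (link c) D@(intoʳ eq _)   = intoˡ eq D
shift-up right (link c) (at _ Dr)        = at leaf (shift-up right c Dr)
shift-up right (link c) D@(intoˡ eq _)   = intoʳ eq D
shift-up right (link c) D@(intoʳ eq _)   = intoʳ eq D

module _ {V W : Set} {ê ê′ : V → Bool} {l r : BinTree V} {i q : V}
         (relaxˡ : ∀ {t : BinTree W} → Embedding ê l t → Embedding ê′ l t)
         (relaxʳ : ∀ {t : BinTree W} → Embedding ê r t → Embedding ê′ r t)
         (q≡0 : ê′ q ≡ false) where

  -- With `ê′ i` contiguous, the alternatives say that i reaches the root of t, or that p(i) can be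
  -- moved into t. The induction follows the path from the root of t to the image of i.
  climb : ∀ s → Chain ê′ (opposite s) (node l i r) → {t : BinTree W} → Embedding ê (node l i r) t →
          Embedding ê′ (node l i r) t ⊎ Embedding ê′ (join s (node l i r) q (leaf tt)) t
  climb s     ch (at Dl Dr) = inj₁ (at (relaxˡ Dl) (relaxʳ Dr))
  climb left  ch (intoˡ _ D) with climb left ch D
  -- Now i is the left child of the root of t, which can serve as the image of q.
  ... | inj₁ E = inj₂ (at E leaf)
  ... | inj₂ E = inj₂ (intoˡ q≡0 E)
  climb left  ch (intoʳ _ D) with climb left ch D
  -- Here i is the child on the other side, and shifting the chain up brings i to the root of t.
  ... | inj₁ E = inj₁ (shift-up right ch E)
  ... | inj₂ E = inj₂ (intoʳ q≡0 E)
  climb right ch (intoˡ _ D) with climb right ch D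
  ... | inj₁ E = inj₁ (shift-up left ch E)
  ... | inj₂ E = inj₂ (intoˡ q≡0 E)
  climb right ch (intoʳ _ D) with climb right ch D
  ... | inj₁ E = inj₂ (at leaf E)
  ... | inj₂ E = inj₂ (intoʳ q≡0 E)

  -- Either i becomes the child of q in place, or `climb` supplies a lower image for q, which its
  -- non-contiguous edge permits.
  lower-parent : ∀ s → Chain ê′ (opposite s) (node l i r) → {t : BinTree W} →
                 Embedding ê (join s (node l i r) q (leaf tt)) t →
                 Embedding ê′ (join s (node l i r) q (leaf tt)) t
  lower-parent left  ch (at Dl _) with climb left ch Dl
  ... | inj₁ E = at E leaf
  ... | inj₂ E = intoˡ q≡0 E
  lower-parent left  ch (intoˡ _ D) = intoˡ q≡0 (lower-parent left ch D)
  lower-parent left  ch (intoʳ _ D) = intoʳ q≡0 (lower-parent left ch D)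
  lower-parent right ch (at _ Dr) with climb right ch Dr
  ... | inj₁ E = at leaf E
  ... | inj₂ E = intoʳ q≡0 E
  lower-parent right ch (intoˡ _ D) = intoˡ q≡0 (lower-parent right ch D)
  lower-parent right ch (intoʳ _ D) = intoʳ q≡0 (lower-parent right ch D)

-- Shifting the chain A(p(i)) downwards

-- One round of the shift: either the goal is reached in t, or the pattern fits one step further
-- towards s, leaving room for the vertices above it to follow.
Slides : (V → Bool) → (V → Bool) → Set → Side → BinTree V → Set
Slides ê ê′ W s p = ∀ {t : BinTree W} → Embedding ê p t → Embedding ê′ p t ⊎ Embedding ê p (sub s t)

-- Lets x be moved up to a new root while p, being floating, stays where it was.
prune : ∀ s → Floating ê p → Embedding ê (join s p x (leaf tt)) t → Embedding ê p t
prune left  fl (at Dl _)   = floatˡ fl Dl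
prune left  fl (intoˡ _ D) = floatˡ fl (prune left fl D)
prune left  fl (intoʳ _ D) = floatʳ fl (prune left fl D)
prune right fl (at _ Dr)   = floatʳ fl Dr
prune right fl (intoˡ _ D) = floatˡ fl (prune right fl D)
prune right fl (intoʳ _ D) = floatʳ fl (prune right fl D)

-- Here x stands for i, and t for the s-subtree at the image of p(i). The image of i is the root of
-- t, or lies towards s, where the shift goes on, or lies on the other side; then i moves up to the
-- root and its floating subtree stays behind.
slides-base : ∀ s → Floating ê p → (∀ {t : BinTree W} → Embedding ê p t → Embedding ê′ p t) →
              Slides ê ê′ W s (join (opposite s) p x (leaf tt))
slides-base left  fl relaxᵖ (at _ Dr)   = inj₁ (at leaf (relaxᵖ Dr))
slides-base left  fl relaxᵖ (intoˡ _ D) = inj₂ D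
slides-base left  fl relaxᵖ (intoʳ _ D) = inj₁ (at leaf (relaxᵖ (prune right fl D)))
slides-base right fl relaxᵖ (at Dl _)   = inj₁ (at (relaxᵖ Dl) leaf)
slides-base right fl relaxᵖ (intoˡ _ D) = inj₁ (at (relaxᵖ (prune left fl D)) leaf)
slides-base right fl relaxᵖ (intoʳ _ D) = inj₂ D

prepend : ∀ s → Embedding ê (node l y r) (sub s t) → Embedding ê (join s (node l y r) x (leaf tt)) t
prepend {t = node _ _ _} left  E = at E leaf
prepend {t = node _ _ _} right E = at leaf E

-- Being contiguous, x is at the root of t; if the pattern below it slides, x follows to the root of
-- `sub s t`.
slides-step : ∀ s → ê x ≡ true → Slides ê ê′ W s (node l y r) →
              Slides ê ê′ W s (join s (node l y r) x (leaf tt))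
slides-step left  x≡1 sl (at {l′ = t} D _) with sl D
... | inj₁ E = inj₁ (at E leaf)
... | inj₂ E = inj₂ (prepend {t = t} left E)
slides-step right x≡1 sl (at {r′ = t} _ D) with sl D
... | inj₁ E = inj₁ (at leaf E)
... | inj₂ E = inj₂ (prepend {t = t} right E)
slides-step left  x≡1 sl (intoˡ x≡0 _) = contradiction (trans (sym x≡1) x≡0) λ ()
slides-step left  x≡1 sl (intoʳ x≡0 _) = contradiction (trans (sym x≡1) x≡0) λ ()
slides-step right x≡1 sl (intoˡ x≡0 _) = contradiction (trans (sym x≡1) x≡0) λ ()
slides-step right x≡1 sl (intoʳ x≡0 _) = contradiction (trans (sym x≡1) x≡0) λ ()

-- At the top of the chain the non-contiguous edge lets x move down. The host is explicit because
-- the recursion descends on it: after a slide, the rebuilt embedding is not a part of the given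
-- one.
slide-down : ∀ s → ê′ x ≡ false → Slides ê ê′ W s (node l y r) → (t : BinTree W) →
             Embedding ê (join s (node l y r) x (leaf tt)) t → Embedding ê′ (join s (node l y r) x (leaf tt)) t
slide-down left  x≡0 sl (node t _ u) (at D _) with sl D
... | inj₁ E = at E leaf
... | inj₂ E = intoˡ x≡0 (slide-down left x≡0 sl t (prepend left E))
slide-down right x≡0 sl (node t _ u) (at _ D) with sl D
... | inj₁ E = at leaf E
... | inj₂ E = intoʳ x≡0 (slide-down right x≡0 sl u (prepend right E))
slide-down left  x≡0 sl (node t _ u) (intoˡ _ D) = intoˡ x≡0 (slide-down left x≡0 sl t D)
slide-down left  x≡0 sl (node t _ u) (intoʳ _ D) = intoʳ x≡0 (slide-down left x≡0 sl u D)
slide-down right x≡0 sl (node t _ u) (intoˡ _ D) = intoˡ x≡0 (slide-down right x≡0 sl t D)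
slide-down right x≡0 sl (node t _ u) (intoʳ _ D) = intoʳ x≡0 (slide-down right x≡0 sl u D)

-- Chains of contiguous edges in the pattern

module _ {k : ℕ} (P : 𝒯 k) where

  full≡join : ∀ s {x} → child P (opposite s) x ≡ nothing → full P x ≡ join s (subtree P s x) x (leaf tt)
  full≡join left  {x} eq = cong (node (subtree P left x) x) (rootOf-nothing eq)
  full≡join right {x} eq = cong (λ l → node l x (subtree P right x)) (rootOf-nothing eq)

  full≡join-opposite : ∀ s {x} → child P s x ≡ nothing →
                       full P x ≡ join (opposite s) (subtree P (opposite s) x) x (leaf tt)
  full≡join-opposite left  = full≡join right
  full≡join-opposite right = full≡join left

  subtree⊆full : ∀ s {x y} → y ∈ᵗ subtree P s x → y ∈ᵗ full P x
  subtree⊆full left  y∈ = inˡ y∈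
  subtree⊆full right y∈ = inʳ y∈

  child^-subtree : ∀ s ℓ {a b y} → child^ P s ℓ a ≡ just b → y ∈ᵗ subtree P s b → y ∈ᵗ subtree P s a
  child^-subtree s zero    refl y∈ = y∈
  child^-subtree s (suc ℓ) {a} eq y∈ with child^ P s ℓ a in eq′
  ... | just b′ = child^-subtree s ℓ eq′ (subst (_ ∈ᵗ_) (sym (subtree≡full P s eq)) (subtree⊆full s y∈))

  module _ (e : EdgeType P) where

    contiguousChain-snoc : ∀ s {ℓ a b c} → ContiguousChain P e s ℓ a b → child P s b ≡ just c →
                           extend P e c ≡ true → ContiguousChain P e s (suc ℓ) a c
    contiguousChain-snoc s {ℓ} {a} {b} {c} (ends , edges) ch c≡1 = ends′ , edges′
      where
      ends′ : child^ P s (suc ℓ) a ≡ just c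
      ends′ = trans (cong (_>>= child P s) ends) ch

      edges′ : ∀ j → 1 ≤ j → j ≤ suc ℓ → ∃[ v ] (child^ P s j a ≡ just (value v) × e v ≡ true)
      edges′ j 1≤j j≤ with m≤n⇒m<n∨m≡n j≤
      ... | inj₁ (s≤s j≤ℓ) = edges j 1≤j j≤ℓ
      ... | inj₂ refl with extend-true P e c c≡1
      ...   | v , refl , v≡1 = v , ends′ , v≡1

    -- A contiguous edge to x puts x into B'(a), so `bare` removes its child on side s; the first
    -- non-contiguous edge ends the chain. The premise on `ê` makes that end floating for the new
    -- edge types.
    chain-below : ∀ s {a b ê} → (∀ {j} → j ∈ B′ P e (opposite s) a → child P s j ≡ nothing) →
                  b ∈ B′ P e (opposite s) a → ∀ p → p ≡ subtree P (opposite s) b →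
                  (∀ {y} → y ∈ᵗ p → extend P e y ≡ false → ê y ≡ false) → Chain ê (opposite s) p
    chain-below s bare b∈ (leaf _) eq h = end leaf
    chain-below s bare b∈ (node l x r) eq h with extend P e x in x≡
    ... | false = end (node (h here x≡))
    chain-below left {a} bare (ℓ , cc) (node l x r) eq h | true =
      subst (λ l → Chain _ right (node l x r)) (sym (trans (cong (sub left) eqˣ) (rootOf-nothing (bare x∈))))
            (link (chain-below left bare x∈ r (cong (sub right) eqˣ) (h ∘ inʳ)))
      where
      x∈ : x ∈ B′ P e right a
      x∈ = suc ℓ , contiguousChain-snoc right cc (cong rootOf (sym eq)) x≡
      eqˣ = trans eq (subtree≡full P right (cong rootOf (sym eq)))
    chain-below right {a} bare (ℓ , cc) (node l x r) eq h | true =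
      subst (λ r → Chain _ left (node l x r)) (sym (trans (cong (sub right) eqˣ) (rootOf-nothing (bare x∈))))
            (link (chain-below right bare x∈ l (cong (sub left) eqˣ) (h ∘ inˡ)))
      where
      x∈ : x ∈ B′ P e left a
      x∈ = suc ℓ , contiguousChain-snoc left cc (cong rootOf (sym eq)) x≡
      eqˣ = trans eq (subtree≡full P left (cong rootOf (sym eq)))

    -- Induction from the bottom b of the chain to its top a: each contiguous vertex is absorbed
    -- into the sliding pattern by `slides-step`, and `slide-down` finishes at a.
    slide-chain : ∀ s {ê′ W} ℓ {a b c} → ContiguousChain P e s ℓ a b → child P s b ≡ just c →
                  (∀ {j} → j ∈ A P e s b → child P (opposite s) j ≡ nothing) →
                  ê′ a ≡ false → Slides (extend P e) ê′ W s (full P c) →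
                  {t : BinTree W} → Embedding (extend P e) (full P a) t → Embedding ê′ (full P a) t
    slide-chain s {ê′} zero {a} {c = c} (refl , edges) ch bare a≡0 sl {t} =
      subst (λ p → Embedding (extend P e) p t → Embedding ê′ p t) (sym full-a) (slide-down s a≡0 sl t)
      where
      full-a : full P a ≡ join s (full P c) a (leaf tt)
      full-a = trans (full≡join s (bare (0 , refl , edges)))
                     (cong (λ p → join s p a (leaf tt)) (subtree≡full P s ch))
    slide-chain s {ê′} {W} (suc ℓ) {a} {b} {c} (ends , edges) ch bare a≡0 sl
      with child^ P s ℓ a in ends′
    ... | just b′ = slide-chain s ℓ (ends′ , λ j 1≤j j≤ℓ → edges j 1≤j (m≤n⇒m≤1+n j≤ℓ)) ends
                      -- A chain ending at b′, prolonged by b, is a chain ending at b; hence A(b′)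
                      -- lies in A(b).
                      (λ { (m , cc) → bare (suc m , contiguousChain-snoc s cc ends b≡1) }) a≡0
                      (subst (Slides (extend P e) ê′ W s) (sym full-b) (slides-step s b≡1 sl))
      where
      b≡1 : extend P e b ≡ true
      b≡1 with edges (suc ℓ) (s≤s z≤n) ≤-refl
      ... | v , eq , v≡1 rewrite ends′ with trans (sym ends) eq
      ...   | refl = trans (extend-value P e v) v≡1

      full-b : full P b ≡ join s (full P c) b (leaf tt)
      full-b = trans (full≡join s (bare (0 , refl , λ { (suc _) _ () })))
                     (cong (λ p → join s p b (leaf tt)) (subtree≡full P s ch))

  -- Vertices in X, Y and Y'

  module _ (e : EdgeType P) (i : NonRoot P) where
    private
      e′ = makeContiguous {P = P} i e
      ê₀ = extend P e
      ê₁ = extend P e′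
      ι  = value i

    keep : ∀ {y} → y ≢ ι → ê₀ y ≡ false → ê₁ y ≡ false
    keep y≢i = trans (extend-makeContiguous-other P i e y≢i)

    extend-antitone : ∀ {y} → ê₁ y ≡ false → ê₀ y ≡ false
    extend-antitone {y} y≡0 with y ≟ ι
    ... | yes refl = contradiction (trans (sym (extend-makeContiguous-self P i e)) y≡0) λ ()
    ... | no y≢i   = trans (sym (extend-makeContiguous-other P i e y≢i)) y≡0

    relax-subtree : ∀ s {t : BinTree W} → Embedding ê₀ (subtree P s ι) t → Embedding ê₁ (subtree P s ι) t
    relax-subtree s = relax λ y∈ → keep (∈-subtree⇒≢ P s y∈)

    relax-tree : ∀ x → ι ∈ᵗ full P x →
                 (∀ {t : BinTree W} → Embedding ê₀ (full P x) t → Embedding ê₁ (full P x) t) →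
                 {t : BinTree W} → Embedding ê₀ (𝒯.tree P) t → Embedding ê₁ (𝒯.tree P) t
    relax-tree {W} x i∈ h =
      relax-within keep (𝒯.search P) c (subst (ι ∈ᵗ_) (sym (treeAt≡full P c)) i∈)
        (subst (λ p → {t : BinTree W} → Embedding ê₀ p t → Embedding ê₁ p t) (sym (treeAt≡full P c)) h)
      where c = 𝒯.position P x

    reembed-X : ι ∈ X P e → {t : BinTree W} → Embedding ê₀ (𝒯.tree P) t → Embedding ê₁ (𝒯.tree P) t
    reembed-X {W} (noˡ , noʳ) = relax-tree ι here
      (subst (λ p → {t : BinTree W} → Embedding ê₀ p t → Embedding ê₁ p t)
             (sym (cong₂ (λ l r → node l ι r) (rootOf-nothing noˡ) (rootOf-nothing noʳ)))
             single-vertex)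

    module _ (s : Side) (Yi : YOn P e s ι) where
      open YOn Yi

      private
        o = opposite s

        i∈B′ : ι ∈ B′ P e o ι
        i∈B′ = 0 , refl , λ { (suc _) _ () }

      i∈subtree-top : ι ∈ᵗ subtree P s top
      i∈subtree-top = let ℓ , ends , _ = proj₁ isTop in child^-subtree s ℓ ends (root∈ isChild)

      -- Since i lies strictly below `top`, the change of edge type at i does not touch `top`.
      top≡0 : ê₁ top ≡ false
      top≡0 = keep (∈-subtree⇒≢ P s i∈subtree-top ∘ sym) (case topEdge of λ where
        (inj₁ isRoot)          → extend-root P e isRoot
        (inj₂ (v , refl , v≡0)) → trans (extend-value P e v) v≡0)

      -- A(p(i)) = {p(i)} makes p(i) its own topmost vertex; being the root or on a non-contiguous
      -- edge, it may be moved down.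
      reembed-A : A P e s q ≐ ｛ q ｝ → {t : BinTree W} → Embedding ê₀ (full P top) t → Embedding ê₁ (full P top) t
      reembed-A {W} (A⊆ , _) =
        subst (λ p → {t : BinTree W} → Embedding ê₀ p t → Embedding ê₁ p t) (sym full-top)
              (lower-parent (relax-subtree left) (relax-subtree right) top≡0 s chain)
        where
        q≡top : q ≡ top
        q≡top = A⊆ (proj₁ isTop)

        full-top : full P top ≡ join s (full P ι) top (leaf tt)
        full-top = trans (full≡join s (above (proj₁ isTop)))
          (cong (λ p → join s p top (leaf tt)) (subtree≡full P s (subst (λ x → child P s x ≡ just ι) q≡top isChild)))

        chain : Chain ê₁ o (full P ι)
        chain = subst (Chain ê₁ o) (sym (full≡join-opposite s (below i∈B′)))
          (link (chain-below e s below i∈B′ _ refl (keep ∘ ∈-subtree⇒≢ P o)))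

      reembed-B : B′ P e o ι ≐ ｛ ι ｝ → {t : BinTree W} → Embedding ê₀ (full P top) t → Embedding ê₁ (full P top) t
      reembed-B {W} (B⊆ , _) = let ℓ , chain = proj₁ isTop in
        slide-chain e s ℓ chain isChild above top≡0
          (subst (Slides ê₀ ê₁ W s) (sym (full≡join-opposite s (below i∈B′)))
                 (slides-base s (floating _ refl) (relax-subtree o)))
        where
        floating : ∀ p → p ≡ subtree P o ι → Floating ê₀ p
        floating (leaf _)     eq = leaf
        floating (node l x r) eq with ê₀ x in x≡
        ... | false = node x≡
        -- A contiguous edge to x would put x into B'(i) = {i}, although x lies strictly below i.
        ... | true  = contradiction
          (sym (B⊆ (1 , contiguousChain-snoc e o (proj₂ i∈B′) (cong rootOf (sym eq)) x≡)))
          (∈-subtree⇒≢ P o (subst (x ∈ᵗ_) eq here))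

      reembed-Y : {t : BinTree W} → Embedding ê₀ (𝒯.tree P) t → Embedding ê₁ (𝒯.tree P) t
      reembed-Y = relax-tree top (subtree⊆full s i∈subtree-top) (case singleton of λ where
        (inj₁ A≐) → reembed-A A≐
        (inj₂ B≐) → reembed-B B≐)

theorem11 : ∀ {k : ℕ} (P : 𝒯 k) (e : EdgeType P) (i : NonRoot P) →
    value i ∈ X P e ∪ Y P e ∪ Y′ P e →
    e i ≡ false →
    ∀ (n : ℕ) → Avoiding n P e ≐ Avoiding n P (makeContiguous {P = P} i e)
theorem11 P e i i∈ _ n =
    -- Contiguity is the stronger demand, so every occurrence for the new edge types is one for `e`.
    (λ avoids → avoids ∘ embedding⇒contains P ∘ relax (λ _ → extend-antitone P e i) ∘ contains⇒embedding P)
  , (λ avoids → avoids ∘ embedding⇒contains P ∘ reembed i∈ ∘ contains⇒embedding P)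
  where
  reembed : value i ∈ X P e ∪ Y P e ∪ Y′ P e → {t : BinTree (Fin n)} →
            Embedding (extend P e) (𝒯.tree P) t → Embedding (extend P (makeContiguous {P = P} i e)) (𝒯.tree P) t
  reembed (inj₁ i∈X)         = reembed-X P e i i∈X
  reembed (inj₂ (inj₁ i∈Y))  = reembed-Y P e i right i∈Y
  reembed (inj₂ (inj₂ i∈Y′)) = reembed-Y P e i left i∈Y′
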